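{- Let $r\ge 1$ be an integer and suppose that $A\subseteq\mathbb{F}_2^r$ is round. If $|A|>\frac13\,2^r+2$, then there are a sum-free set $S\subseteq\mathbb{F}_2^r$ and an element $g\in\mathbb{F}_2^r$ such that $A=g+(S\cup\{0\})$.
   Context: $\mathbb{F}_2^r$ denotes the elementary abelian $2$-group of rank $r$. For $X\subseteq\mathbb{F}_2^r$, $2X:=\{x_1+x_2\colon x_1,x_2\in X\}$ (with $x_1=x_2$ allowed), and $g+X:=\{g+x\colon x\in X\}$. A set $A\subseteq\mathbb{F}_2^r$ is round if $2B\ne 2A$ for every proper subset $B\subsetneq A$. A set $S$ is sum-free if $S\cap 2S=\varnothing$. -}

module Defs where

open import Data.Bool using (Bool; true; false; _xor_)
open import Data.Nat using (ℕ; zero; suc)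
open import Data.Vec using (Vec; []; _∷_; replicate; zipWith)
open import Data.List using (List; []; _∷_; map; _++_; filter; length)
open import Data.Product using (Σ; _×_; ∃; _,_)
open import Data.Sum using (_⊎_)
open import Relation.Binary.PropositionalEquality using (_≡_)
open import Relation.Nullary using (¬_)
open import Data.Bool using (T)
open import Relation.Nullary.Decidable using (Dec)
open import Data.Bool.Properties using (T?)

F₂^ : ℕ → Set
F₂^ r = Vec Bool r

infixl 6 _⊕_
_⊕_ : ∀ {r} → F₂^ r → F₂^ r → F₂^ r
_⊕_ = zipWith _xor_

𝟘 : ∀ {r} → F₂^ r
𝟘 = replicate _ false

Subset : ℕ → Set
Subset r = F₂^ r → Bool

_∈_ : ∀ {r} → F₂^ r → Subset r → Set
x ∈ A = A x ≡ true

_⊆_ : ∀ {r} → Subset r → Subset r → Set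
B ⊆ A = ∀ x → x ∈ B → x ∈ A

_⊊_ : ∀ {r} → Subset r → Subset r → Set
B ⊊ A = B ⊆ A × ∃ λ x → x ∈ A × ¬ (x ∈ B)

_≐_ : ∀ {r} → (F₂^ r → Set) → (F₂^ r → Set) → Set
P ≐ Q = ∀ x → (P x → Q x) × (Q x → P x)

2· : ∀ {r} → Subset r → F₂^ r → Set
2· X x = ∃ λ x₁ → ∃ λ x₂ → x₁ ∈ X × x₂ ∈ X × x ≡ x₁ ⊕ x₂

allVecs : ∀ r → List (F₂^ r)
allVecs zero = [] ∷ []
allVecs (suc r) = map (false ∷_) (allVecs r) ++ map (true ∷_) (allVecs r)

∣_∣ : ∀ {r} → Subset r → ℕ
∣_∣ {r} A = length (filter (λ x → T? (A x)) (allVecs r))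

Round : ∀ {r} → Subset r → Set
Round A = ∀ B → B ⊊ A → ¬ (2· B ≐ 2· A)

SumFree : ∀ {r} → Subset r → Set
SumFree S = ∀ x → x ∈ S → ¬ (2· S x)

shift∪0 : ∀ {r} → F₂^ r → Subset r → F₂^ r → Set
shift∪0 g S x = ∃ λ y → (y ∈ S ⊎ y ≡ 𝟘) × x ≡ g ⊕ y

{-# OPTIONS --safe #-}
-- Join a, b ∈ A by an edge when a + b has no representation in 2A other than a + b and
-- b + a. Roundness says that no vertex is isolated, and the conclusion says that some g is
-- joined to every other vertex.  For an edge sum d, the sets A and A + d share at most two
-- elements, so edge sums d₁ + d₂ = d₃ would give three almost disjoint translates of A, and
-- 3|A| ≤ 2^r + 6.  Hence the edge sums form a sum-free set and the graph has no triangles.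
-- For an edge ab let W be the set of sums of the edges that avoid a and b.  The sets a + A,
-- b + A, W and W + (a + b) are disjoint up to two elements, so 2|A| + 2|W| ≤ 2^r + 2 and
-- therefore 2|W| + 2 < |A|.  If every vertex outside {a, b} had a neighbour outside {a, b},
-- then x ↦ x + (such a neighbour) would be two-to-one into W, which is impossible.  So every
-- edge has a leaf attached to one of its ends: every edge contains a centre, that is, a
-- vertex with leaves.  If c₁ ≠ c₂ are centres, c₁ having no more leaves than c₂, then an edge
-- from c₁ to one of its leaves is avoided by too many edges.  So the centre is unique and
-- every edge contains it.
module Submission where

open import Defs
open import Data.Nat using (ℕ; _+_; _*_; _^_; _<_; _≥_)
open import Data.Product using (Σ; ∃; _×_)

open import Data.Bool using (Bool; true; false)
open import Data.Bool.Properties using (T?; xor-assoc; xor-comm; xor-identityˡ; xor-same)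
import Data.Bool.Properties as Bool
open import Data.Empty using (⊥; ⊥-elim)
open import Data.List using ([]; _∷_; map; filter; length)
open import Data.List.Properties using (filter-++; length-++)
open import Data.Nat using (zero; suc; _≤_; z≤n)
open import Data.Nat.Properties hiding (_≟_)
open import Data.Nat.Solver using (module +-*-Solver)
open import Data.Product using (_,_; proj₁; proj₂)
open import Data.Sum using (_⊎_; inj₁; inj₂; [_,_]′; swap)
open import Data.Vec using ([]; _∷_)
open import Data.Vec.Properties using (≡-dec; ∷-injectiveˡ; ∷-injectiveʳ; zipWith-assoc; zipWith-comm; zipWith-identityˡ)
open import Function using (_∘_; id)
open import Relation.Binary.PropositionalEquality using (_≡_; _≢_; refl; sym; trans; cong; cong₂; subst)
open import Relation.Nullary using (¬_; Dec; yes; no; does; ¬?; _×-dec_; _⊎-dec_; _→-dec_)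
open import Relation.Nullary.Decidable using (map′; dec-true)
open import Relation.Unary using (Decidable)
open import Relation.Unary.Properties using (_∪?_; _∩?_; U?)

-- The group F₂^r

private variable
  r s : ℕ

_≟_ : (x y : F₂^ r) → Dec (x ≡ y)
_≟_ = ≡-dec Bool._≟_

⊕-assoc : (x y z : F₂^ r) → (x ⊕ y) ⊕ z ≡ x ⊕ (y ⊕ z)
⊕-assoc = zipWith-assoc xor-assoc

⊕-comm : (x y : F₂^ r) → x ⊕ y ≡ y ⊕ x
⊕-comm = zipWith-comm xor-comm

⊕-identityˡ : (x : F₂^ r) → 𝟘 ⊕ x ≡ x
⊕-identityˡ = zipWith-identityˡ xor-identityˡ

⊕-identityʳ : (x : F₂^ r) → x ⊕ 𝟘 ≡ x
⊕-identityʳ x = trans (⊕-comm x 𝟘) (⊕-identityˡ x)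

⊕-self : (x : F₂^ r) → x ⊕ x ≡ 𝟘
⊕-self []      = refl
⊕-self (b ∷ x) = cong₂ _∷_ (xor-same b) (⊕-self x)

x⊕[x⊕y]≡y : (x y : F₂^ r) → x ⊕ (x ⊕ y) ≡ y
x⊕[x⊕y]≡y x y =
  trans (sym (⊕-assoc x x y)) (trans (cong (_⊕ y) (⊕-self x)) (⊕-identityˡ y))

[x⊕y]⊕y≡x : (x y : F₂^ r) → (x ⊕ y) ⊕ y ≡ x
[x⊕y]⊕y≡x x y =
  trans (⊕-assoc x y y) (trans (cong (x ⊕_) (⊕-self y)) (⊕-identityʳ x))

x⊕[y⊕x]≡y : (x y : F₂^ r) → x ⊕ (y ⊕ x) ≡ y
x⊕[y⊕x]≡y x y = trans (cong (x ⊕_) (⊕-comm y x)) (x⊕[x⊕y]≡y x y)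

[x⊕y]⊕[x⊕z]≡y⊕z : (x y z : F₂^ r) → (x ⊕ y) ⊕ (x ⊕ z) ≡ y ⊕ z
[x⊕y]⊕[x⊕z]≡y⊕z x y z = trans (cong (_⊕ (x ⊕ z)) (⊕-comm x y))
  (trans (⊕-assoc y x (x ⊕ z)) (cong (y ⊕_) (x⊕[x⊕y]≡y x z)))

⊕-cancelˡ : (x : F₂^ r) {y z : F₂^ r} → x ⊕ y ≡ x ⊕ z → y ≡ z
⊕-cancelˡ x {y} {z} eq =
  trans (sym (x⊕[x⊕y]≡y x y)) (trans (cong (x ⊕_) eq) (x⊕[x⊕y]≡y x z))

⊕-cancelʳ : (x : F₂^ r) {y z : F₂^ r} → y ⊕ x ≡ z ⊕ x → y ≡ z
⊕-cancelʳ x {y} {z} eq =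
  trans (sym ([x⊕y]⊕y≡x y x)) (trans (cong (_⊕ x) eq) ([x⊕y]⊕y≡x z x))

does-true⇒ : {P : Set} (P? : Dec P) → does P? ≡ true → P
does-true⇒ (yes p) _ = p

-- Edges, leaves and centres are defined by quantifying over the group. Deciding the quantifiers by
-- exhaustion is what allows them to be counted.
∃? : {P : F₂^ r → Set} → Decidable P → Dec (∃ P)
∃? {zero} P? = map′ ([] ,_) (λ { ([] , p) → p }) (P? [])
∃? {suc r} P? = map′
  [ (λ (x , p) → false ∷ x , p) , (λ (x , p) → true ∷ x , p) ]′
  (λ { (false ∷ x , p) → inj₁ (x , p) ; (true ∷ x , p) → inj₂ (x , p) })
  (∃? (P? ∘ (false ∷_)) ⊎-dec ∃? (P? ∘ (true ∷_)))

∀? : {P : F₂^ r → Set} → Decidable P → Dec (∀ x → P x)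
∀? {zero} P? = map′ (λ { p [] → p }) (λ p → p []) (P? [])
∀? {suc r} P? = map′
  (λ { (p , q) (false ∷ x) → p x ; (p , q) (true ∷ x) → q x })
  (λ p → (p ∘ (false ∷_)) , (p ∘ (true ∷_)))
  (∀? (P? ∘ (false ∷_)) ×-dec ∀? (P? ∘ (true ∷_)))

-- Sums over F₂^r and cardinalities of decidable predicates

∑ : (F₂^ r → ℕ) → ℕ
∑ {zero}  f = f []
∑ {suc r} f = ∑ (f ∘ (false ∷_)) + ∑ (f ∘ (true ∷_))

∑-mono : {f g : F₂^ r → ℕ} → (∀ x → f x ≤ g x) → ∑ f ≤ ∑ g
∑-mono {zero}  f≤g = f≤g []
∑-mono {suc r} f≤g = +-mono-≤ (∑-mono (f≤g ∘ (false ∷_))) (∑-mono (f≤g ∘ (true ∷_)))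

interchange : ∀ a b c d → (a + b) + (c + d) ≡ (a + c) + (b + d)
interchange = solve 4 (λ a b c d → (a :+ b) :+ (c :+ d) := (a :+ c) :+ (b :+ d)) refl
  where open +-*-Solver

∑-+ : (f g : F₂^ r → ℕ) → ∑ (λ x → f x + g x) ≡ ∑ f + ∑ g
∑-+ {zero}  f g = refl
∑-+ {suc r} f g = trans
  (cong₂ _+_ (∑-+ (f ∘ (false ∷_)) (g ∘ (false ∷_))) (∑-+ (f ∘ (true ∷_)) (g ∘ (true ∷_))))
  (interchange (∑ (f ∘ (false ∷_))) (∑ (g ∘ (false ∷_))) (∑ (f ∘ (true ∷_))) (∑ (g ∘ (true ∷_))))

∑-* : (k : ℕ) (f : F₂^ r → ℕ) → ∑ (λ x → k * f x) ≡ k * ∑ f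
∑-* {zero}  k f = refl
∑-* {suc r} k f = trans (cong₂ _+_ (∑-* k (f ∘ (false ∷_))) (∑-* k (f ∘ (true ∷_))))
  (sym (*-distribˡ-+ k (∑ (f ∘ (false ∷_))) (∑ (f ∘ (true ∷_)))))

∑-swap : (f : F₂^ r → F₂^ s → ℕ) → ∑ (λ x → ∑ (f x)) ≡ ∑ (λ y → ∑ (λ x → f x y))
∑-swap {zero}  f = refl
∑-swap {suc r} f = trans
  (cong₂ _+_ (∑-swap (f ∘ (false ∷_))) (∑-swap (f ∘ (true ∷_))))
  (sym (∑-+ (λ y → ∑ (λ x → f (false ∷ x) y)) (λ y → ∑ (λ x → f (true ∷ x) y))))

-- A leading `true` in `g` exchanges the two halves of the sum, a leading `false` keeps them.
∑-shift : (g : F₂^ r) (f : F₂^ r → ℕ) → ∑ (λ x → f (x ⊕ g)) ≡ ∑ f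
∑-shift []          f = refl
∑-shift (false ∷ g) f = cong₂ _+_ (∑-shift g (f ∘ (false ∷_))) (∑-shift g (f ∘ (true ∷_)))
∑-shift (true ∷ g)  f = trans
  (cong₂ _+_ (∑-shift g (f ∘ (true ∷_))) (∑-shift g (f ∘ (false ∷_))))
  (+-comm (∑ (f ∘ (true ∷_))) (∑ (f ∘ (false ∷_))))

term≤∑ : (f : F₂^ r → ℕ) (x : F₂^ r) → f x ≤ ∑ f
term≤∑ f []          = ≤-refl
term≤∑ f (false ∷ x) = ≤-trans (term≤∑ (f ∘ (false ∷_)) x) (m≤m+n _ _)
term≤∑ f (true ∷ x)  = ≤-trans (term≤∑ (f ∘ (true ∷_)) x) (m≤n+m _ _)

indicator : {P : Set} → Dec P → ℕ
indicator (yes _) = 1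
indicator (no _)  = 0

indicator-≤ : {P : Set} {n : ℕ} (P? : Dec P) → (P → 1 ≤ n) → indicator P? ≤ n
indicator-≤ (yes p) h = h p
indicator-≤ (no _)  h = z≤n

indicator-≥ : {P : Set} (P? : Dec P) → P → 1 ≤ indicator P?
indicator-≥ (yes _) p = ≤-refl
indicator-≥ (no ¬p) p = ⊥-elim (¬p p)

# : {P : F₂^ r → Set} → Decidable P → ℕ
# P? = ∑ (λ x → indicator (P? x))

#-U : ∀ r → # (U? {A = F₂^ r}) ≡ 2 ^ r
#-U zero    = refl
#-U (suc r) = cong₂ _+_ (#-U r) (trans (#-U r) (sym (+-identityʳ (2 ^ r))))

length-filter-map : ∀ {a b} {X : Set a} {Y : Set b} (f : X → Y) (P : Y → Bool) xs →
  length (filter (T? ∘ P) (map f xs)) ≡ length (filter (T? ∘ P ∘ f) xs)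
length-filter-map f P []       = refl
length-filter-map f P (x ∷ xs) with P (f x)
... | true  = cong suc (length-filter-map f P xs)
... | false = length-filter-map f P xs

-- `allVecs` splits by the leading bit just as `∑` does. This ties the list-based cardinality of the
-- theorem to the count `#`.
∣∣≡# : (A : Subset r) → ∣ A ∣ ≡ # (λ x → A x Bool.≟ true)
∣∣≡# {zero} A with A []
... | true  = refl
... | false = refl
∣∣≡# {suc r} A = trans
  (cong length (filter-++ (T? ∘ A) (map (false ∷_) (allVecs r)) (map (true ∷_) (allVecs r))))
  (trans (length-++ (filter (T? ∘ A) (map (false ∷_) (allVecs r))))
    (cong₂ _+_
      (trans (length-filter-map (false ∷_) A (allVecs r)) (∣∣≡# (A ∘ (false ∷_))))
      (trans (length-filter-map (true ∷_) A (allVecs r)) (∣∣≡# (A ∘ (true ∷_))))))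

module _ {P Q : F₂^ r → Set} (P? : Decidable P) (Q? : Decidable Q) where

  #-mono : (∀ x → P x → Q x) → # P? ≤ # Q?
  #-mono P⊆Q = ∑-mono λ x → indicator-≤ (P? x) (indicator-≥ (Q? x) ∘ P⊆Q x)

  #-∪≤ : # (P? ∪? Q?) ≤ # P? + # Q?
  #-∪≤ = ≤-trans
    (∑-mono λ x → indicator-≤ ((P? ∪? Q?) x)
      [ (λ p → ≤-trans (indicator-≥ (P? x) p) (m≤m+n _ _))
      , (λ q → ≤-trans (indicator-≥ (Q? x) q) (m≤n+m _ _)) ]′)
    (≤-reflexive (∑-+ (indicator ∘ P?) (indicator ∘ Q?)))

  #-inclusion-exclusion : # P? + # Q? ≤ # (P? ∪? Q?) + # (P? ∩? Q?)
  #-inclusion-exclusion = begin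
    # P? + # Q?                                     ≡⟨ ∑-+ (indicator ∘ P?) (indicator ∘ Q?) ⟨
    ∑ (λ x → indicator (P? x) + indicator (Q? x))   ≤⟨ ∑-mono (λ x → pointwise (P? x) (Q? x)) ⟩
    ∑ (λ x → indicator ((P? ∪? Q?) x) + indicator ((P? ∩? Q?) x))
      ≡⟨ ∑-+ (indicator ∘ (P? ∪? Q?)) (indicator ∘ (P? ∩? Q?)) ⟩
    # (P? ∪? Q?) + # (P? ∩? Q?)                     ∎
    where
    open ≤-Reasoning
    pointwise : {X Y : Set} (x? : Dec X) (y? : Dec Y) →
      indicator x? + indicator y? ≤ indicator (x? ⊎-dec y?) + indicator (x? ×-dec y?)
    pointwise (yes _) (yes _) = ≤-refl
    pointwise (yes _) (no _)  = ≤-refl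
    pointwise (no _)  (yes _) = ≤-refl
    pointwise (no _)  (no _)  = ≤-refl

module _ {P Q R : F₂^ r → Set} (P? : Decidable P) (Q? : Decidable Q) (R? : Decidable R) where

  #-cover : (∀ x → P x → Q x ⊎ R x) → # P? ≤ # Q? + # R?
  #-cover P⊆Q∪R = ≤-trans (#-mono P? (Q? ∪? R?) P⊆Q∪R) (#-∪≤ Q? R?)

  #-disjoint : (∀ x → P x → R x) → (∀ x → Q x → R x) → (∀ x → P x → Q x → ⊥) →
    # P? + # Q? ≤ # R?
  #-disjoint P⊆R Q⊆R disj = ≤-trans
    (≤-reflexive (sym (∑-+ (indicator ∘ P?) (indicator ∘ Q?))))
    (∑-mono λ x → pointwise (P? x) (Q? x) (R? x) (P⊆R x) (Q⊆R x) (disj x))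
    where
    pointwise : {X Y Z : Set} (x? : Dec X) (y? : Dec Y) (z? : Dec Z) →
      (X → Z) → (Y → Z) → (X → Y → ⊥) → indicator x? + indicator y? ≤ indicator z?
    pointwise (yes x) (yes y) z? f g h = ⊥-elim (h x y)
    pointwise (yes x) (no _)  z? f g h = indicator-≥ z? (f x)
    pointwise (no _)  y?      z? f g h = indicator-≤ y? (indicator-≥ z? ∘ g)

#-empty : {P : F₂^ r → Set} (P? : Decidable P) → (∀ x → ¬ P x) → # P? ≤ 0
#-empty {zero}  P? ¬P = indicator-≤ (P? []) (⊥-elim ∘ ¬P [])
#-empty {suc r} P? ¬P = +-mono-≤
  (#-empty (P? ∘ (false ∷_)) (¬P ∘ (false ∷_)))
  (#-empty (P? ∘ (true ∷_)) (¬P ∘ (true ∷_)))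

#≤1 : {P : F₂^ r → Set} (P? : Decidable P) (p : F₂^ r) → (∀ x → P x → x ≡ p) → # P? ≤ 1
#≤1 P? []          P⊆p = indicator-≤ (P? []) (λ _ → ≤-refl)
#≤1 P? (false ∷ p) P⊆p = +-mono-≤
  (#≤1 (P? ∘ (false ∷_)) p (λ x → ∷-injectiveʳ ∘ P⊆p (false ∷ x)))
  (#-empty (P? ∘ (true ∷_)) λ x q → true≢false (∷-injectiveˡ (P⊆p (true ∷ x) q)))
  where
  true≢false : true ≢ false
  true≢false ()
#≤1 P? (true ∷ p)  P⊆p = +-mono-≤
  (#-empty (P? ∘ (false ∷_)) λ x q → false≢true (∷-injectiveˡ (P⊆p (false ∷ x) q)))
  (#≤1 (P? ∘ (true ∷_)) p (λ x → ∷-injectiveʳ ∘ P⊆p (true ∷ x)))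
  where
  false≢true : false ≢ true
  false≢true ()

#≤2 : {P : F₂^ r → Set} (P? : Decidable P) (p q : F₂^ r) →
  (∀ x → P x → x ≡ p ⊎ x ≡ q) → # P? ≤ 2
#≤2 P? p q P⊆pq = ≤-trans (#-cover P? (_≟ p) (_≟ q) P⊆pq)
  (+-mono-≤ (#≤1 (_≟ p) p (λ _ → id)) (#≤1 (_≟ q) q (λ _ → id)))

-- The pairs of `y` in `Q` and `x` with `R y x` are counted in two ways: at least one for each `x`
-- in `P`, at most `k` for each `y` in `Q`.
#-double-count : {P : F₂^ r → Set} {Q : F₂^ s → Set} {R : F₂^ s → F₂^ r → Set}
  (P? : Decidable P) (Q? : Decidable Q) (R? : ∀ y → Decidable (R y)) (k : ℕ) →
  (∀ x → P x → ∃ λ y → Q y × R y x) → (∀ y → Q y → # (R? y) ≤ k) → # P? ≤ k * # Q?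
#-double-count P? Q? R? k hit fibre = begin
  # P?                              ≤⟨ ∑-mono (λ x → indicator-≤ (P? x) (covered x)) ⟩
  ∑ (λ x → ∑ (λ y → pair y x))      ≡⟨ ∑-swap (λ x y → pair y x) ⟩
  ∑ (λ y → ∑ (λ x → pair y x))      ≤⟨ ∑-mono fibre′ ⟩
  ∑ (λ y → k * indicator (Q? y))    ≡⟨ ∑-* k (indicator ∘ Q?) ⟩
  k * # Q?                          ∎
  where
  open ≤-Reasoning
  pair : _ → _ → ℕ
  pair y x = indicator (Q? y ×-dec R? y x)

  covered : ∀ x → _ → 1 ≤ ∑ (λ y → pair y x)
  covered x p with hit x p
  ... | y , q , ρ = ≤-trans (indicator-≥ (Q? y ×-dec R? y x) (q , ρ)) (term≤∑ (λ y → pair y x) y)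

  fibre′ : ∀ y → ∑ (λ x → pair y x) ≤ k * indicator (Q? y)
  fibre′ y = case (Q? y)
    where
    -- With the decision as an argument, `indicator` computes in either case.
    case : (q? : Dec _) → # (λ x → q? ×-dec R? y x) ≤ k * indicator q?
    case (yes q) = ≤-trans (#-mono (λ x → yes q ×-dec R? y x) (R? y) (λ _ → proj₂))
      (≤-trans (fibre y q) (≤-reflexive (sym (*-identityʳ k))))
    case (no ¬q) = ≤-trans (#-empty (λ x → no ¬q ×-dec R? y x) (λ _ → ¬q ∘ proj₁)) z≤n

#-shift : {P : F₂^ r → Set} (P? : Decidable P) (g : F₂^ r) → # (λ x → P? (x ⊕ g)) ≡ # P?
#-shift P? g = ∑-shift g (indicator ∘ P?)

-- The unique-representation graph

module UniqueSums {r : ℕ} (A : Subset r) where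

  ∈A? : Decidable (_∈ A)
  ∈A? x = A x Bool.≟ true

  -- A representation of `a ⊕ b` is recorded by its first summand `y`. Equivalently, with d = a + b,
  -- the intersection of `A` and A + d lies in {a, b}; this is the form used in the counts.
  Unique : F₂^ r → F₂^ r → Set
  Unique a b = ∀ y → y ∈ A → (y ⊕ (a ⊕ b)) ∈ A → y ≡ a ⊎ y ≡ b

  Edge : F₂^ r → F₂^ r → Set
  Edge a b = a ∈ A × b ∈ A × Unique a b

  edge? : ∀ a b → Dec (Edge a b)
  edge? a b = ∈A? a ×-dec ∈A? b ×-dec
    ∀? λ y → ∈A? y →-dec (∈A? (y ⊕ (a ⊕ b)) →-dec (y ≟ a ⊎-dec y ≟ b))

  edge-sym : ∀ {a b} → Edge a b → Edge b a
  edge-sym {a} {b} (a∈A , b∈A , uniq) = b∈A , a∈A , λ y y∈A y′∈A →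
    swap (uniq y y∈A (subst (λ d → (y ⊕ d) ∈ A) (⊕-comm b a) y′∈A))

  -- If `a` were isolated, every sum a + b with `b` in `A`, the case b = a included, would have a
  -- representation other than a + b and b + a, hence one free of `a`. Deleting `a` would then leave
  -- the doubled set unchanged.
  round⇒neighbour : Round A → ∀ a → a ∈ A → ∃ (Edge a)
  round⇒neighbour round a a∈A with ∃? (edge? a)
  ... | yes e = e
  ... | no ¬e = ⊥-elim (round B (B⊆A , a , a∈A , λ a∈B → proj₂ (B-elim a∈B) refl) 2B≐2A)
    where
    B? : ∀ x → Dec (x ∈ A × x ≢ a)
    B? x = ∈A? x ×-dec ¬? (x ≟ a)

    B : Subset r
    B x = does (B? x)

    B-elim : ∀ {x} → x ∈ B → x ∈ A × x ≢ a
    B-elim {x} = does-true⇒ (B? x)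

    B-intro : ∀ {x} → x ∈ A → x ≢ a → x ∈ B
    B-intro {x} x∈A x≢a = dec-true (B? x) (x∈A , x≢a)

    B⊆A : B ⊆ A
    B⊆A x x∈B = proj₁ (B-elim x∈B)

    a⊕-∈2B : ∀ {b} → b ∈ A → 2· B (a ⊕ b)
    a⊕-∈2B {b} b∈A
      with ∃? (λ y → ∈A? y ×-dec ∈A? (y ⊕ (a ⊕ b)) ×-dec ¬? (y ≟ a) ×-dec ¬? (y ≟ b))
    ... | yes (y , y∈A , y′∈A , y≢a , y≢b) =
      y , y ⊕ (a ⊕ b) , B-intro y∈A y≢a , B-intro y′∈A y′≢a , sym (x⊕[x⊕y]≡y y (a ⊕ b))
      where
      y′≢a : y ⊕ (a ⊕ b) ≢ a
      y′≢a eq = y≢b (⊕-cancelʳ (a ⊕ b) (trans eq (sym (x⊕[y⊕x]≡y b a))))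
    ... | no ¬y = ⊥-elim (¬e (b , a∈A , b∈A , uniq))
      where
      uniq : Unique a b
      uniq y y∈A y′∈A with y ≟ a | y ≟ b
      ... | yes eq | _      = inj₁ eq
      ... | no _   | yes eq = inj₂ eq
      ... | no y≢a | no y≢b = ⊥-elim (¬y (y , y∈A , y′∈A , y≢a , y≢b))

    2B≐2A : 2· B ≐ 2· A
    2B≐2A x = (λ (y , z , y∈B , z∈B , eq) → y , z , B⊆A y y∈B , B⊆A z z∈B , eq) , back
      where
      back : 2· A x → 2· B x
      back (y , z , y∈A , z∈A , refl) with y ≟ a | z ≟ a
      ... | yes refl | _        = a⊕-∈2B z∈A
      ... | no _     | yes refl = subst (2· B) (⊕-comm a y) (a⊕-∈2B y∈A)
      ... | no y≢a   | no z≢a   = y , z , B-intro y∈A y≢a , B-intro z∈A z≢a , refl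

  -- Spanning stars and translated sum-free sets

  SpanningStar : F₂^ r → Set
  SpanningStar g = g ∈ A × (∀ x → x ∈ A → x ≢ g → Edge g x)

  -- `S` is g + A without 0. If y = u + v within `S`, the sum of the edge from `g` to g + y is also
  -- (g + u) + (g + v), so g + u is `g` or g + y. That means u = 0 or v = 0.
  spanningStar⇒shift : ∀ {g} → SpanningStar g →
    ∃ λ (S : Subset r) → ∃ λ (g : F₂^ r) → SumFree S × ((λ x → x ∈ A) ≐ shift∪0 g S)
  spanningStar⇒shift {g} (g∈A , star) = S , g , sumFree , λ x → to x , from x
    where
    S? : ∀ y → Dec ((g ⊕ y) ∈ A × y ≢ 𝟘)
    S? y = ∈A? (g ⊕ y) ×-dec ¬? (y ≟ 𝟘)

    S : Subset r
    S y = does (S? y)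

    S-elim : ∀ {y} → y ∈ S → (g ⊕ y) ∈ A × y ≢ 𝟘
    S-elim {y} = does-true⇒ (S? y)

    sumFree : SumFree S
    sumFree y y∈S (u , v , u∈S , v∈S , refl) with S-elim y∈S | S-elim u∈S | S-elim v∈S
    ... | gy∈A , y≢𝟘 | gu∈A , u≢𝟘 | gv∈A , v≢𝟘 =
      [ (λ eq → u≢𝟘 (⊕-cancelˡ g (trans eq (sym (⊕-identityʳ g)))))
      , (λ eq → v≢𝟘 (sym (⊕-cancelˡ u (trans (⊕-identityʳ u) (⊕-cancelˡ g eq)))))
      ]′ (proj₂ (proj₂ (star (g ⊕ (u ⊕ v)) gy∈A gy≢g)) (g ⊕ u) gu∈A
           (subst (_∈ A) (sym gu+) gv∈A))
      where
      gy≢g : g ⊕ (u ⊕ v) ≢ g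
      gy≢g eq = y≢𝟘 (⊕-cancelˡ g (trans eq (sym (⊕-identityʳ g))))
      gu+ : (g ⊕ u) ⊕ (g ⊕ (g ⊕ (u ⊕ v))) ≡ g ⊕ v
      gu+ = trans (cong ((g ⊕ u) ⊕_) (x⊕[x⊕y]≡y g (u ⊕ v)))
        (trans (⊕-assoc g u (u ⊕ v)) (cong (g ⊕_) (x⊕[x⊕y]≡y u v)))

    to : ∀ x → x ∈ A → shift∪0 g S x
    to x x∈A with x ≟ g
    ... | yes refl = 𝟘 , inj₂ refl , sym (⊕-identityʳ g)
    ... | no x≢g = g ⊕ x , inj₁ (dec-true (S? (g ⊕ x)) (subst (_∈ A) x≡ x∈A , gx≢𝟘)) , x≡
      where
      x≡ : x ≡ g ⊕ (g ⊕ x)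
      x≡ = sym (x⊕[x⊕y]≡y g x)
      gx≢𝟘 : g ⊕ x ≢ 𝟘
      gx≢𝟘 eq = x≢g (trans x≡ (trans (cong (g ⊕_) eq) (⊕-identityʳ g)))

    from : ∀ x → shift∪0 g S x → x ∈ A
    from x (y , inj₁ y∈S , refl) = proj₁ (S-elim y∈S)
    from x (y , inj₂ refl , refl) = subst (_∈ A) (sym (⊕-identityʳ g)) g∈A

  -- Almost disjoint translates of `A`

  ∣A∣ : ℕ
  ∣A∣ = # ∈A?

  -- The translates `A`, A + d₁ and A + d₂ differ pairwise by `d₁`, `d₂` and d₁ + d₂, all of them
  -- edge sums. Each of the three intersections thus has at most two elements, which accounts for
  -- the 6.
  edge-triangle-bound : ∀ {a₁ b₁ a₂ b₂ a₃ b₃} → Edge a₁ b₁ → Edge a₂ b₂ → Edge a₃ b₃ →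
    (a₁ ⊕ b₁) ⊕ (a₂ ⊕ b₂) ≡ a₃ ⊕ b₃ → 3 * ∣A∣ ≤ 2 ^ r + 6
  edge-triangle-bound {a₁} {b₁} {a₂} {b₂} {a₃} {b₃} e₁ e₂ e₃ sum = begin
    3 * ∣A∣                   ≡⟨ rearrange ∣A∣ ⟩
    (∣A∣ + ∣A∣) + ∣A∣         ≡⟨ cong₂ (λ m n → (∣A∣ + m) + n) (#-shift ∈A? d₁) (#-shift ∈A? d₂) ⟨
    (# P? + # Q?) + # R?      ≤⟨ +-monoˡ-≤ (# R?) (#-inclusion-exclusion P? Q?) ⟩
    (# (P? ∪? Q?) + # (P? ∩? Q?)) + # R?
                              ≤⟨ +-monoˡ-≤ (# R?) (+-monoʳ-≤ (# (P? ∪? Q?)) PQ≤2) ⟩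
    (# (P? ∪? Q?) + 2) + # R? ≡⟨ rearrange′ (# (P? ∪? Q?)) (# R?) ⟩
    (# (P? ∪? Q?) + # R?) + 2 ≤⟨ +-monoˡ-≤ 2 (#-inclusion-exclusion (P? ∪? Q?) R?) ⟩
    (# ((P? ∪? Q?) ∪? R?) + # ((P? ∪? Q?) ∩? R?)) + 2
                              ≤⟨ +-monoˡ-≤ 2 (+-mono-≤ all≤ PQR≤4) ⟩
    (2 ^ r + 4) + 2           ≡⟨ +-assoc (2 ^ r) 4 2 ⟩
    2 ^ r + 6                 ∎
    where
    open ≤-Reasoning
    open +-*-Solver
    rearrange : ∀ n → 3 * n ≡ (n + n) + n
    rearrange = solve 1 (λ n → con 3 :* n := (n :+ n) :+ n) refl
    rearrange′ : ∀ m n → (m + 2) + n ≡ (m + n) + 2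
    rearrange′ = solve 2 (λ m n → (m :+ con 2) :+ n := (m :+ n) :+ con 2) refl
    d₁ = a₁ ⊕ b₁
    d₂ = a₂ ⊕ b₂
    P? = ∈A?
    Q? = λ z → ∈A? (z ⊕ d₁)
    R? = λ z → ∈A? (z ⊕ d₂)
    PQ≤2 : # (P? ∩? Q?) ≤ 2
    PQ≤2 = #≤2 (P? ∩? Q?) a₁ b₁ λ z (p , q) → proj₂ (proj₂ e₁) z p q
    PR≤2 : # (P? ∩? R?) ≤ 2
    PR≤2 = #≤2 (P? ∩? R?) a₂ b₂ λ z (p , q) → proj₂ (proj₂ e₂) z p q
    QR≤2 : # (Q? ∩? R?) ≤ 2
    -- Translation by `d₁` carries this intersection to that of `A` and its translate by a₃ + b₃, so
    -- the endpoints of the third edge appear shifted by `d₁`.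
    QR≤2 = #≤2 (Q? ∩? R?) (a₃ ⊕ d₁) (b₃ ⊕ d₁) λ z (p , q) →
      [ inj₁ ∘ move z , inj₂ ∘ move z ]′ (proj₂ (proj₂ e₃) (z ⊕ d₁) p (subst (_∈ A) (step z) q))
      where
      move : ∀ z {a} → z ⊕ d₁ ≡ a → z ≡ a ⊕ d₁
      move z refl = sym ([x⊕y]⊕y≡x z d₁)
      step : ∀ z → z ⊕ d₂ ≡ (z ⊕ d₁) ⊕ (a₃ ⊕ b₃)
      step z = sym (trans (cong ((z ⊕ d₁) ⊕_) (sym sum))
        (trans (⊕-assoc z d₁ (d₁ ⊕ d₂)) (cong (z ⊕_) (x⊕[x⊕y]≡y d₁ d₂))))
    PQR≤4 : # ((P? ∪? Q?) ∩? R?) ≤ 4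
    PQR≤4 = ≤-trans
      (#-cover ((P? ∪? Q?) ∩? R?) (P? ∩? R?) (Q? ∩? R?)
        λ { z (inj₁ p , ρ) → inj₁ (p , ρ) ; z (inj₂ q , ρ) → inj₂ (q , ρ) })
      (+-mono-≤ PR≤2 QR≤2)
    all≤ : # ((P? ∪? Q?) ∪? R?) ≤ 2 ^ r
    all≤ = ≤-trans (#-mono ((P? ∪? Q?) ∪? R?) U? _) (≤-reflexive (#-U r))

  -- For a, b ∈ A the last two conditions say that neither a nor b is an endpoint of the edge
  -- with sum w.
  Avoiding : F₂^ r → F₂^ r → F₂^ r → Set
  Avoiding a b w = (∃ λ x → Edge x (x ⊕ w)) × ¬ ((a ⊕ w) ∈ A) × ¬ ((b ⊕ w) ∈ A)

  avoiding? : ∀ a b → Decidable (Avoiding a b)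
  avoiding? a b w = ∃? (λ x → edge? x (x ⊕ w)) ×-dec ¬? (∈A? (a ⊕ w)) ×-dec ¬? (∈A? (b ⊕ w))

  -- If a + (x + y) were in `A`, then `a` would be the first summand of a representation of x + y,
  -- and uniqueness would make it `x` or `y`. The same goes for `b`.
  avoiding : ∀ {a b x y} → a ∈ A → b ∈ A → Edge x y →
    x ≢ a → x ≢ b → y ≢ a → y ≢ b → Avoiding a b (x ⊕ y)
  avoiding {a} {b} {x} {y} a∈A b∈A e@(x∈A , y∈A , uniq) x≢a x≢b y≢a y≢b =
    (x , subst (Edge x) (sym (x⊕[x⊕y]≡y x y)) e) ,
    [ x≢a ∘ sym , y≢a ∘ sym ]′ ∘ uniq a a∈A ,
    [ x≢b ∘ sym , y≢b ∘ sym ]′ ∘ uniq b b∈A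

  endpoints : ∀ {x w} → Edge x (x ⊕ w) → ∀ y → y ∈ A → (y ⊕ w) ∈ A → y ≡ x ⊎ y ≡ x ⊕ w
  endpoints {x} {w} (_ , _ , uniq) y y∈A y⊕w∈A =
    uniq y y∈A (subst (λ d → (y ⊕ d) ∈ A) (sym (x⊕[x⊕y]≡y x w)) y⊕w∈A)

  -- Counting edge sums when `A` is large

  module Large (large : 2 ^ r + 6 < 3 * ∣A∣) where

    edge-sums-sumFree : ∀ {a₁ b₁ a₂ b₂ a₃ b₃} → Edge a₁ b₁ → Edge a₂ b₂ → Edge a₃ b₃ →
      (a₁ ⊕ b₁) ⊕ (a₂ ⊕ b₂) ≢ a₃ ⊕ b₃
    edge-sums-sumFree e₁ e₂ e₃ sum = <⇒≱ large (edge-triangle-bound e₁ e₂ e₃ sum)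

    -- Let d = a + b and let W be the set of avoiding sums. A common element w of W and W + d would
    -- give three edge sums w, w + d and d, against `edge-sums-sumFree`. The last two conditions in
    -- `Avoiding` keep W, and hence W + d, off a + A and b + A, which share at most two elements.
    avoiding-bound : ∀ {a b} → Edge a b →
      (∣A∣ + ∣A∣) + (# (avoiding? a b) + # (avoiding? a b)) ≤ 2 ^ r + 2
    avoiding-bound {a} {b} e@(a∈A , b∈A , uniq) = begin
      (∣A∣ + ∣A∣) + (# R? + # R?)
        ≡⟨ cong₂ _+_ (cong₂ _+_ (#-shift ∈A? a) (#-shift ∈A? b))
                     (cong (# R? +_) (#-shift R? d)) ⟨
      (# P? + # Q?) + (# R? + # S?)
        ≤⟨ +-mono-≤ (#-inclusion-exclusion P? Q?)
             (#-disjoint R? S? (R? ∪? S?) (λ _ → inj₁) (λ _ → inj₂) R∩S) ⟩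
      (# (P? ∪? Q?) + # (P? ∩? Q?)) + # (R? ∪? S?)
        ≤⟨ +-monoˡ-≤ (# (R? ∪? S?)) (+-monoʳ-≤ (# (P? ∪? Q?)) PQ≤2) ⟩
      (# (P? ∪? Q?) + 2) + # (R? ∪? S?)
        ≡⟨ rearrange (# (P? ∪? Q?)) (# (R? ∪? S?)) ⟩
      (# (P? ∪? Q?) + # (R? ∪? S?)) + 2
        ≤⟨ +-monoˡ-≤ 2 (#-disjoint (P? ∪? Q?) (R? ∪? S?) U? _ _ PQ∩RS) ⟩
      # (U? {A = F₂^ r}) + 2
        ≡⟨ cong (_+ 2) (#-U r) ⟩
      2 ^ r + 2 ∎
      where
      open ≤-Reasoning
      open +-*-Solver
      rearrange : ∀ m n → (m + 2) + n ≡ (m + n) + 2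
      rearrange = solve 2 (λ m n → (m :+ con 2) :+ n := (m :+ n) :+ con 2) refl
      d = a ⊕ b
      P? = λ z → ∈A? (z ⊕ a)
      Q? = λ z → ∈A? (z ⊕ b)
      R? = avoiding? a b
      S? = λ z → R? (z ⊕ d)
      z⊕a⊕d : ∀ z → (z ⊕ a) ⊕ d ≡ z ⊕ b
      z⊕a⊕d z = trans (⊕-assoc z a d) (cong (z ⊕_) (x⊕[x⊕y]≡y a b))
      PQ≤2 : # (P? ∩? Q?) ≤ 2
      PQ≤2 = #≤2 (P? ∩? Q?) (a ⊕ a) (b ⊕ a) λ z (p , q) →
        [ inj₁ ∘ move z , inj₂ ∘ move z ]′ (uniq (z ⊕ a) p (subst (_∈ A) (sym (z⊕a⊕d z)) q))
        where
        move : ∀ z {c} → z ⊕ a ≡ c → z ≡ c ⊕ a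
        move z refl = sym ([x⊕y]⊕y≡x z a)
      R∩S : ∀ z → Avoiding a b z → Avoiding a b (z ⊕ d) → ⊥
      R∩S z ((x , ex) , _) ((y , ey) , _) = edge-sums-sumFree ex ey e
        (trans (cong₂ _⊕_ (x⊕[x⊕y]≡y x z) (x⊕[x⊕y]≡y y (z ⊕ d))) (x⊕[x⊕y]≡y z d))
      -- Since a + d = b, translation by `d` exchanges the roles of `a` and `b`.
      a⊕ : ∀ z → a ⊕ (z ⊕ d) ≡ z ⊕ b
      a⊕ z = trans (⊕-comm a (z ⊕ d)) (trans (⊕-assoc z d a)
        (cong (z ⊕_) (trans (⊕-comm d a) (x⊕[x⊕y]≡y a b))))
      b⊕ : ∀ z → b ⊕ (z ⊕ d) ≡ z ⊕ a
      b⊕ z = trans (⊕-comm b (z ⊕ d)) (trans (⊕-assoc z d b) (cong (z ⊕_) ([x⊕y]⊕y≡x a b)))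
      PQ∩RS : ∀ z → (z ⊕ a) ∈ A ⊎ (z ⊕ b) ∈ A → Avoiding a b z ⊎ Avoiding a b (z ⊕ d) → ⊥
      PQ∩RS z (inj₁ p) (inj₁ (_ , ¬a , ¬b)) = ¬a (subst (_∈ A) (⊕-comm z a) p)
      PQ∩RS z (inj₁ p) (inj₂ (_ , ¬a , ¬b)) = ¬b (subst (_∈ A) (sym (b⊕ z)) p)
      PQ∩RS z (inj₂ q) (inj₁ (_ , ¬a , ¬b)) = ¬b (subst (_∈ A) (⊕-comm z b) q)
      PQ∩RS z (inj₂ q) (inj₂ (_ , ¬a , ¬b)) = ¬a (subst (_∈ A) (sym (a⊕ z)) q)

    -- The extra 2 on the left makes room for two exceptional vertices in the later counts. It fits
    -- because 2^r + 2 + 2 is still below 2^r + 6.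
    few-avoiding : ∀ {a b} → Edge a b → # (avoiding? a b) + # (avoiding? a b) + 2 < ∣A∣
    few-avoiding {a} {b} e = +-cancelˡ-< (∣A∣ + ∣A∣) _ _ (begin-strict
      (∣A∣ + ∣A∣) + (w + w + 2)  ≡⟨ +-assoc (∣A∣ + ∣A∣) (w + w) 2 ⟨
      (∣A∣ + ∣A∣) + (w + w) + 2  ≤⟨ +-monoˡ-≤ 2 (avoiding-bound e) ⟩
      2 ^ r + 2 + 2              ≡⟨ +-assoc (2 ^ r) 2 2 ⟩
      2 ^ r + 4                  ≤⟨ +-monoʳ-≤ (2 ^ r) (m≤m+n 4 2) ⟩
      2 ^ r + 6                  <⟨ large ⟩
      3 * ∣A∣                    ≡⟨ rearrange ∣A∣ ⟩
      (∣A∣ + ∣A∣) + ∣A∣          ∎)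
      where
      open ≤-Reasoning
      open +-*-Solver
      w = # (avoiding? a b)
      rearrange : ∀ n → 3 * n ≡ (n + n) + n
      rearrange = solve 1 (λ n → con 3 :* n := (n :+ n) :+ n) refl

    -- Pendant vertices of an edge

    module _ (neighbour : ∀ a → a ∈ A → ∃ (Edge a)) where

      -- When `w` is an edge sum, only the two ends of that edge satisfy this, so a sum can stand
      -- for its edge.
      incident? : ∀ w → Decidable (λ x → x ∈ A × (x ⊕ w) ∈ A)
      incident? w x = ∈A? x ×-dec ∈A? (x ⊕ w)

      neighbourAvoiding? : ∀ a b v → Dec (∃ λ u → Edge v u × u ≢ a × u ≢ b)
      neighbourAvoiding? a b v = ∃? λ u → edge? v u ×-dec ¬? (u ≟ a) ×-dec ¬? (u ≟ b)

      Pendant : F₂^ r → F₂^ r → F₂^ r → Set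
      Pendant a b v = (v ∈ A × v ≢ a × v ≢ b) × ¬ ∃ λ u → Edge v u × u ≢ a × u ≢ b

      pendant? : ∀ a b → Dec (∃ (Pendant a b))
      pendant? a b = ∃? λ v →
        (∈A? v ×-dec ¬? (v ≟ a) ×-dec ¬? (v ≟ b)) ×-dec ¬? (neighbourAvoiding? a b v)

      edge⇒pendant : ∀ {a b} → Edge a b → ∃ (Pendant a b)
      edge⇒pendant {a} {b} e@(a∈A , b∈A , _) with pendant? a b
      ... | yes p = p
      ... | no ¬p = ⊥-elim (<⇒≱ (few-avoiding e) (begin
        ∣A∣                ≤⟨ #-cover ∈A? Rest? Pair? split ⟩
        # Rest? + # Pair?  ≤⟨ +-mono-≤ (#-double-count Rest? W? incident? 2 hit fibre)
                                       (#≤2 Pair? a b (λ _ → id)) ⟩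
        2 * # W? + 2       ≡⟨ cong (λ n → # W? + n + 2) (+-identityʳ (# W?)) ⟩
        # W? + # W? + 2    ∎))
        where
        open ≤-Reasoning
        W? = avoiding? a b
        Pair? : Decidable (λ x → x ≡ a ⊎ x ≡ b)
        Pair? x = x ≟ a ⊎-dec x ≟ b
        Rest? : Decidable (λ x → x ∈ A × x ≢ a × x ≢ b)
        Rest? x = ∈A? x ×-dec ¬? (x ≟ a) ×-dec ¬? (x ≟ b)
        split : ∀ x → x ∈ A → (x ∈ A × x ≢ a × x ≢ b) ⊎ (x ≡ a ⊎ x ≡ b)
        split x x∈A with x ≟ a | x ≟ b
        ... | yes eq | _      = inj₂ (inj₁ eq)
        ... | no _   | yes eq = inj₂ (inj₂ eq)
        ... | no x≢a | no x≢b = inj₁ (x∈A , x≢a , x≢b)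
        hit : ∀ x → x ∈ A × x ≢ a × x ≢ b →
          ∃ λ w → Avoiding a b w × x ∈ A × (x ⊕ w) ∈ A
        hit x p@(x∈A , x≢a , x≢b) with neighbourAvoiding? a b x
        ... | no ¬u = ⊥-elim (¬p (x , p , ¬u))
        ... | yes (u , xu , u≢a , u≢b) =
          x ⊕ u , avoiding a∈A b∈A xu x≢a x≢b u≢a u≢b , x∈A ,
          subst (_∈ A) (sym (x⊕[x⊕y]≡y x u)) (proj₁ (proj₂ xu))
        -- An edge sum determines its edge, so at most the two ends of that edge are sent to `w`.
        fibre : ∀ w → Avoiding a b w → # (incident? w) ≤ 2
        fibre w ((x , e′) , _) = #≤2 (incident? w) x (x ⊕ w) λ y (p , q) → endpoints e′ y p q

      -- Leaves and centres

      Leaf : F₂^ r → F₂^ r → Set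
      Leaf c v = Edge v c × (∀ u → Edge v u → u ≡ c)

      leaf? : ∀ c → Decidable (Leaf c)
      leaf? c v = edge? v c ×-dec ∀? λ u → edge? v u →-dec u ≟ c

      Centre : F₂^ r → Set
      Centre c = ∃ (Leaf c)

      centre? : Decidable Centre
      centre? c = ∃? (leaf? c)

      -- The edge sums being sum-free, the graph has no triangles, so a pendant vertex has
      -- only one neighbour.
      edge⇒leaf : ∀ {a b} → Edge a b → ∃ λ v → v ≢ a × v ≢ b × (Leaf a v ⊎ Leaf b v)
      edge⇒leaf {a} {b} e with edge⇒pendant e
      ... | v , (v∈A , v≢a , v≢b) , ¬u = v , v≢a , v≢b , leaf
        where
        only : ∀ u → Edge v u → u ≡ a ⊎ u ≡ b
        only u vu with u ≟ a | u ≟ b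
        ... | yes eq | _      = inj₁ eq
        ... | no _   | yes eq = inj₂ eq
        ... | no u≢a | no u≢b = ⊥-elim (¬u (u , vu , u≢a , u≢b))
        notBoth : Edge v a → ¬ Edge v b
        notBoth va vb = edge-sums-sumFree va vb e ([x⊕y]⊕[x⊕z]≡y⊕z v a b)
        leaf : Leaf a v ⊎ Leaf b v
        leaf with neighbour v v∈A
        ... | u , vu with only u vu
        ... | inj₁ refl = inj₁ (vu , λ t vt →
                [ id , (λ { refl → ⊥-elim (notBoth vu vt) }) ]′ (only t vt))
        ... | inj₂ refl = inj₂ (vu , λ t vt →
                [ (λ { refl → ⊥-elim (notBoth vt vu) }) , id ]′ (only t vt))

      edge⇒centre : ∀ {a b} → Edge a b → Centre a ⊎ Centre b
      edge⇒centre e with edge⇒leaf e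
      ... | v , _ , _ , inj₁ l = inj₁ (v , l)
      ... | v , _ , _ , inj₂ l = inj₂ (v , l)

      -- Otherwise `v` and `c` would have no neighbours but each other, whereas `edge⇒leaf` attaches
      -- a further leaf to one of them.
      leaf⇒¬centre : ∀ {c v} → Leaf c v → ¬ Centre v
      leaf⇒¬centre {c} {v} (vc , onlyc) (w , wv , onlyv) with onlyc w (edge-sym wv)
      ... | refl with edge⇒leaf vc
      ... | u , u≢v , u≢c , inj₁ (uv , _) = u≢c (onlyc u (edge-sym uv))
      ... | u , u≢v , u≢c , inj₂ (uc , _) = u≢v (onlyv u (edge-sym uc))

      -- The bound `A≤` is added to itself. In one copy `C` is replaced by L′ + 2, in the other `L₁`
      -- by `L₂`. The terms `C`, `L₁`, `L₂`, `L′` then count disjoint parts of `A`, leaving |A| at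
      -- most 2W + 2, against `few-avoiding` for the edge from `c₁` to its leaf `v₁`.
      leaf-counts-incomparable : ∀ {c₁ c₂} → c₁ ≢ c₂ → Centre c₁ →
        ¬ (# (leaf? c₁) ≤ # (leaf? c₂))
      leaf-counts-incomparable {c₁} {c₂} c₁≢c₂ (v₁ , l₁@(v₁c₁ , only₁)) l₁≤l₂ =
        <⇒≱ (few-avoiding v₁c₁) (+-cancelˡ-≤ ∣A∣ _ _ (begin
          ∣A∣ + ∣A∣
            ≤⟨ +-mono-≤ A≤ A≤ ⟩
          (C + (L₁ + W)) + (C + (L₁ + W))
            ≤⟨ +-mono-≤ (+-monoˡ-≤ (L₁ + W) C≤) (+-monoʳ-≤ C (+-monoˡ-≤ W l₁≤l₂)) ⟩
          ((L′ + 2) + (L₁ + W)) + (C + (L₂ + W))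
            ≡⟨ rearrange C L₁ L₂ L′ W ⟩
          (C + (L₁ + (L₂ + L′))) + (W + W + 2)
            ≤⟨ +-monoˡ-≤ (W + W + 2) ≤A ⟩
          ∣A∣ + (W + W + 2) ∎))
        where
        open ≤-Reasoning
        open +-*-Solver
        rearrange : ∀ c l₁ l₂ l′ w →
          ((l′ + 2) + (l₁ + w)) + (c + (l₂ + w)) ≡ (c + (l₁ + (l₂ + l′))) + (w + w + 2)
        rearrange = solve 5 (λ c l₁ l₂ l′ w →
          ((l′ :+ con 2) :+ (l₁ :+ w)) :+ (c :+ (l₂ :+ w)) :=
          (c :+ (l₁ :+ (l₂ :+ l′))) :+ (w :+ w :+ con 2)) refl

        W? = avoiding? v₁ c₁
        OtherLeaf : F₂^ r → Set
        OtherLeaf v = ∃ λ c → Leaf c v × c ≢ c₁ × c ≢ c₂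
        otherLeaf? : Decidable OtherLeaf
        otherLeaf? v = ∃? λ c → leaf? c v ×-dec ¬? (c ≟ c₁) ×-dec ¬? (c ≟ c₂)
        C = # centre?
        L₁ = # (leaf? c₁)
        L₂ = # (leaf? c₂)
        L′ = # otherLeaf?
        W = # W?

        leaf-unique : ∀ {c c′ v} → Leaf c v → Leaf c′ v → c ≡ c′
        leaf-unique {c} (vc , _) (_ , only) = only c vc

        leaf∈A : ∀ {c} v → Leaf c v → v ∈ A
        leaf∈A v ((v∈A , _) , _) = v∈A

        -- Disjointness: a leaf is no centre, and it has just one neighbour to be a leaf of.
        ≤A : C + (L₁ + (L₂ + L′)) ≤ ∣A∣
        ≤A = ≤-trans (+-monoʳ-≤ C (≤-trans (+-monoʳ-≤ L₁ L₂L′) L₁L₂L′))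
          (#-disjoint centre? (leaf? c₁ ∪? (leaf? c₂ ∪? otherLeaf?)) ∈A?
            (λ { c (v , (_ , c∈A , _) , _) → c∈A })
            (λ { v (inj₁ l) → leaf∈A v l
               ; v (inj₂ (inj₁ l)) → leaf∈A v l
               ; v (inj₂ (inj₂ (_ , l , _))) → leaf∈A v l })
            (λ { v cv (inj₁ l) → leaf⇒¬centre l cv
               ; v cv (inj₂ (inj₁ l)) → leaf⇒¬centre l cv
               ; v cv (inj₂ (inj₂ (_ , l , _))) → leaf⇒¬centre l cv }))
          where
          L₂L′ : L₂ + L′ ≤ # (leaf? c₂ ∪? otherLeaf?)
          L₂L′ = #-disjoint (leaf? c₂) otherLeaf? (leaf? c₂ ∪? otherLeaf?)
            (λ _ → inj₁) (λ _ → inj₂) λ { v l (_ , l′ , _ , c≢c₂) → c≢c₂ (leaf-unique l′ l) }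
          L₁L₂L′ : L₁ + # (leaf? c₂ ∪? otherLeaf?) ≤ # (leaf? c₁ ∪? (leaf? c₂ ∪? otherLeaf?))
          L₁L₂L′ = #-disjoint (leaf? c₁) (leaf? c₂ ∪? otherLeaf?)
            (leaf? c₁ ∪? (leaf? c₂ ∪? otherLeaf?)) (λ _ → inj₁) (λ _ → inj₂)
            λ { v l (inj₁ l′) → c₁≢c₂ (leaf-unique l l′)
              ; v l (inj₂ (_ , l′ , c≢c₁ , _)) → c≢c₁ (leaf-unique l′ l) }

        -- Each centre other than `c₁` and `c₂` owns a leaf, and no two centres share one.
        C≤ : C ≤ L′ + 2
        C≤ = ≤-trans (#-cover centre? Other? Pair? split)
          (+-mono-≤
            (≤-trans (#-double-count Other? otherLeaf? (λ v c → leaf? c v) 1 hit fibre)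
                     (≤-reflexive (*-identityˡ L′)))
            (#≤2 Pair? c₁ c₂ (λ _ → id)))
          where
          Other : F₂^ r → Set
          Other c = Centre c × c ≢ c₁ × c ≢ c₂
          Other? : Decidable Other
          Other? c = centre? c ×-dec ¬? (c ≟ c₁) ×-dec ¬? (c ≟ c₂)
          Pair? : Decidable (λ c → c ≡ c₁ ⊎ c ≡ c₂)
          Pair? c = c ≟ c₁ ⊎-dec c ≟ c₂
          split : ∀ c → Centre c → Other c ⊎ (c ≡ c₁ ⊎ c ≡ c₂)
          split c cc with c ≟ c₁ | c ≟ c₂
          ... | yes eq  | _       = inj₂ (inj₁ eq)
          ... | no _    | yes eq  = inj₂ (inj₂ eq)
          ... | no c≢c₁ | no c≢c₂ = inj₁ (cc , c≢c₁ , c≢c₂)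
          hit : ∀ c → Other c → ∃ λ v → OtherLeaf v × Leaf c v
          hit c ((v , l) , c≢c₁ , c≢c₂) = v , (c , l , c≢c₁ , c≢c₂) , l
          fibre : ∀ v → OtherLeaf v → # (λ c → leaf? c v) ≤ 1
          fibre v (c , l , _) = #≤1 (λ c → leaf? c v) c λ c′ l′ → leaf-unique l′ l

        -- The vertices that are neither centres nor leaves of `c₁` are mapped one-to-one to sums of
        -- edges avoiding `v₁` and `c₁`.
        A≤ : ∣A∣ ≤ C + (L₁ + W)
        A≤ = ≤-trans
          (#-cover ∈A? centre? (leaf? c₁ ∪? Other?) split)
          (+-monoʳ-≤ C (≤-trans (#-∪≤ (leaf? c₁) Other?) (+-monoʳ-≤ L₁
            (≤-trans (#-double-count Other? W? outer? 1 hit fibre)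
                     (≤-reflexive (*-identityˡ W))))))
          where
          Other : F₂^ r → Set
          Other x = x ∈ A × ¬ Centre x × ¬ Leaf c₁ x
          Other? : Decidable Other
          Other? x = ∈A? x ×-dec ¬? (centre? x) ×-dec ¬? (leaf? c₁ x)
          outer? : ∀ w → Decidable (λ x → (x ∈ A × (x ⊕ w) ∈ A) × ¬ Centre x)
          outer? w x = incident? w x ×-dec ¬? (centre? x)
          split : ∀ x → x ∈ A → Centre x ⊎ (Leaf c₁ x ⊎ Other x)
          split x x∈A with centre? x | leaf? c₁ x
          ... | yes c | _     = inj₁ c
          ... | no _  | yes l = inj₂ (inj₁ l)
          ... | no ¬c | no ¬l = inj₂ (inj₂ (x∈A , ¬c , ¬l))
          hit : ∀ x → Other x →
            ∃ λ w → Avoiding v₁ c₁ w × (x ∈ A × (x ⊕ w) ∈ A) × ¬ Centre x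
          hit x (x∈A , ¬c , ¬l) with ∃? (λ u → edge? x u ×-dec ¬? (u ≟ c₁))
          -- The edge avoids `v₁`: `x` is not a leaf of `c₁`, and u = v₁ would force x = c₁. It
          -- avoids `c₁`, since `x` is no centre and `u` was chosen different from `c₁`.
          ... | yes (u , xu , u≢c₁) = x ⊕ u ,
            avoiding (proj₁ v₁c₁) (proj₁ (proj₂ v₁c₁)) xu
              (λ { refl → ¬l l₁ }) x≢c₁
              (λ { refl → x≢c₁ (only₁ x (edge-sym xu)) }) u≢c₁ ,
            (x∈A , subst (_∈ A) (sym (x⊕[x⊕y]≡y x u)) (proj₁ (proj₂ xu))) , ¬c
            where
            x≢c₁ : x ≢ c₁
            x≢c₁ refl = ¬c (v₁ , l₁)
          ... | no ¬u = ⊥-elim (¬l (subst (Edge x) (only u xu) xu , only))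
            where
            only : ∀ u → Edge x u → u ≡ c₁
            only u xu with u ≟ c₁
            ... | yes eq = eq
            ... | no u≢c₁ = ⊥-elim (¬u (u , xu , u≢c₁))
            u = proj₁ (neighbour x x∈A)
            xu = proj₂ (neighbour x x∈A)
          -- Every edge contains a centre, so at most one end of the edge with sum `w` is a
          -- non-centre. This improves the factor 2 of `edge⇒pendant` to 1.
          fibre : ∀ w → Avoiding v₁ c₁ w → # (outer? w) ≤ 1
          fibre w ((x , e) , _) with edge⇒centre e
          ... | inj₁ cx = #≤1 (outer? w) (x ⊕ w) λ y ((p , q) , ¬c) →
                [ (λ { refl → ⊥-elim (¬c cx) }) , id ]′ (endpoints e y p q)
          ... | inj₂ cw = #≤1 (outer? w) x λ y ((p , q) , ¬c) →
                [ id , (λ { refl → ⊥-elim (¬c cw) }) ]′ (endpoints e y p q)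

      centre-unique : ∀ {c₁ c₂} → Centre c₁ → Centre c₂ → c₁ ≡ c₂
      centre-unique {c₁} {c₂} cc₁ cc₂ with c₁ ≟ c₂
      ... | yes eq = eq
      ... | no c₁≢c₂ = ⊥-elim
        ([ leaf-counts-incomparable c₁≢c₂ cc₁ , leaf-counts-incomparable (c₁≢c₂ ∘ sym) cc₂ ]′
          (≤-total (# (leaf? c₁)) (# (leaf? c₂))))

      -- Every vertex lies on an edge, and every edge contains a centre, which can only be `c`.
      centre⇒spanningStar : ∀ {c} → Centre c → SpanningStar c
      centre⇒spanningStar {c} cc@(_ , (_ , c∈A , _) , _) = c∈A , adjacent
        where
        adjacent : ∀ x → x ∈ A → x ≢ c → Edge c x
        adjacent x x∈A x≢c with neighbour x x∈A
        ... | y , xy with edge⇒centre xy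
        ... | inj₁ cx = ⊥-elim (x≢c (centre-unique cx cc))
        ... | inj₂ cy = edge-sym (subst (Edge x) (centre-unique cy cc) xy)

-- The size hypothesis is |A| > 2^r/3 + 2 with the denominator cleared.
theorem3p3 : (r : ℕ) → r ≥ 1 → (A : Subset r) → Round A →
    2 ^ r + 6 < 3 * ∣ A ∣ →
    ∃ λ (S : Subset r) → ∃ λ (g : F₂^ r) →
    SumFree S × ((λ x → x ∈ A) ≐ shift∪0 g S)
theorem3p3 r _ A round large = spanningStar⇒shift (proj₂ star)
  where
  open UniqueSums A
  large′ : 2 ^ r + 6 < 3 * ∣A∣
  large′ = subst (λ n → 2 ^ r + 6 < 3 * n) (∣∣≡# A) large
  open Large large′
  neighbour = round⇒neighbour round
  nonempty : ∃ (_∈ A)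
  nonempty with ∃? ∈A?
  ... | yes p = p
  ... | no ¬p = ⊥-elim (m<n⇒n≢0 large′ (cong (3 *_) (n≤0⇒n≡0 (#-empty ∈A? λ x p → ¬p (x , p)))))
  star : ∃ SpanningStar
  -- Any single edge provides a centre, as one of its ends.
  star with neighbour (proj₁ nonempty) (proj₂ nonempty)
  ... | y , e with edge⇒centre neighbour e
  ... | inj₁ c = _ , centre⇒spanningStar neighbour c
  ... | inj₂ c = _ , centre⇒spanningStar neighbour c
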